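{- Let $b\geq 2$ and $e\geq 1$ be integers, and let $$d=\left\lceil \frac{g(e)+1}{1-\left(\frac{b-2}{b-1}\right)^{e}}+e+p_{e,b}\right\rceil.$$ Let $h\ge 0$ and $u\geq 1$ be integers. If $\sigma_{h,e,b}(u)\geq b^{d}$, then $$S_{e,b}(\sigma_{h+1,e,b}(u))=\sigma_{h,e,b}(u).$$
   Context: For integers $b\ge 2$ and $e\ge 1$, $S_{e,b}$ is the function on positive integers sending $x=\sum_{i=0}^{n-1}a_i b^i$ (with digits $0\le a_i\le b-1$) to $S_{e,b}(x)=\sum_{i=0}^{n-1}a_i^e$. $S_{e,b}^{h}$ denotes the $h$-fold iterate, with $S_{e,b}^0(x)=x$. For a positive integer $u$ (the attractor), a positive integer $x$ is a height $h$, $u$ attracted number if $h$ is the smallest nonnegative integer with $S_{e,b}^h(x)=u$. $\sigma_{h,e,b}(u)$ denotes the smallest height $h$, $u$ attracted number, i.e. the smallest positive integer $k$ with $S_{e,b}^h(k)=u$ and $S_{e,b}^m(k)\neq u$ for all $0\le m<h$. $g(e)$ denotes the smallest integer such that every nonnegative integer can be written as $x_1^e+x_2^e+\dots+x_{g(e)}^e$ with $x_1,\dots,x_{g(e)}$ nonnegative integers (Waring's problem). $p_{e,b}$ denotes the smallest integer such that $b^{p_{e,b}}>g(e)$. -}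

module Defs where

open import Data.Nat.Base as ℕ
  using (ℕ; zero; suc; _∸_; _≤_; NonZero; NonTrivial; 2+)
open import Data.Nat.Properties as ℕ using ()
open import Data.Nat.GeneralisedArithmetic using (iterate)
open import Data.Digit using (toDigits)
open import Data.Fin.Base using (toℕ)
import Data.List.Base as List
open import Data.Nat.ListAction using (sum)
import Data.Vec.Base as Vec
open import Data.Integer.Base as ℤ using (+_; ∣_∣)
import Data.Integer.Properties as ℤ
open import Data.Rational.Base as ℚ
  using (ℚ; 0ℚ; 1ℚ; _+_; _-_; _*_; _÷_; _/_; ceiling)
import Data.Rational.Properties as ℚ
import Data.Rational.Unnormalised.Base as ℚᵘ
import Data.Rational.Unnormalised.Properties as ℚᵘ
open import Algebra.Definitions.RawSemiring ℚ.+-*-rawSemiring using (_^_)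
open import Data.Product.Base using (∃; _×_; proj₁)
open import Relation.Nullary.Decidable using (fromWitness)
open import Relation.Binary.PropositionalEquality using (_≡_; sym; subst)

IsLeast : (ℕ → Set) → ℕ → Set
IsLeast P n = P n × (∀ m → P m → n ≤ m)

-- Any leading zeros returned by toDigits are harmless when e ≥ 1.
S : (e b : ℕ) .{{_ : NonTrivial b}} → ℕ → ℕ
S e b x = sum (List.map (λ a → toℕ a ℕ.^ e) digits)
  where digits = proj₁ (toDigits b {fromWitness (ℕ.nonTrivial⇒n>1 b)} x)

-- x is a height h, u attracted number.
Attracted : (h e b : ℕ) .{{_ : NonTrivial b}} (u x : ℕ) → Set
Attracted h e b u x =
  IsLeast (λ m → iterate (S e b) x m ≡ u) h

-- Isσ h e b u k says that k = σ_{h,e,b}(u).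
Isσ : (h e b : ℕ) .{{_ : NonTrivial b}} (u k : ℕ) → Set
Isσ h e b u = IsLeast (λ k → 1 ≤ k × Attracted h e b u k)

SumsOfPowers : (e g : ℕ) → Set
SumsOfPowers e g =
  ∀ n → ∃ λ (xs : Vec.Vec ℕ g) → Vec.sum (Vec.map (ℕ._^ e) xs) ≡ n

-- IsWaring e g says that g = g(e).  It is a relation because a function g
-- would need a proof of Hilbert's theorem that g(e) exists.
IsWaring : (e g : ℕ) → Set
IsWaring e = IsLeast (SumsOfPowers e)

-- IsExponent b g p says that p is the smallest integer with b ^ p > g.  For
-- b ≥ 2, negative integers p never qualify when g ≥ 1, as holds for g = g(e).
IsExponent : (b g p : ℕ) → Set
IsExponent b g = IsLeast (λ p → g ℕ.< b ℕ.^ p)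

ratio : (b : ℕ) .{{_ : NonTrivial b}} → ℚ
ratio b@(2+ _) = + (b ∸ 2) / (b ∸ 1)

ratio-nonNeg : ∀ b .{{_ : NonTrivial b}} → 0ℚ ℚ.≤ ratio b
ratio-nonNeg (2+ k) =
  ℚ.nonNegative⁻¹ (ratio (2+ k)) {{ℚ.normalize-nonNeg k (suc k)}}

ratio<1 : ∀ b .{{_ : NonTrivial b}} → ratio b ℚ.< 1ℚ
ratio<1 (2+ k) = ℚ.toℚᵘ-cancel-<
  (ℚᵘ.<-respˡ-≃ (ℚᵘ.≃-sym (ℚ.toℚᵘ-fromℚᵘ (ℚᵘ.mkℚᵘ (+ k) k))) (ℚᵘ.*<* k*1<1*[1+k]))
  where
  k*1<1*[1+k] : + k ℤ.* + 1 ℤ.< + 1 ℤ.* + suc k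
  k*1<1*[1+k] rewrite ℤ.*-identityʳ (+ k) | ℤ.*-identityˡ (+ suc k) =
    ℤ.+<+ (ℕ.n<1+n k)

^<1 : ∀ q → 0ℚ ℚ.≤ q → q ℚ.< 1ℚ → ∀ e .{{_ : NonZero e}} → q ^ e ℚ.< 1ℚ
^<1 q 0≤q q<1 (suc zero) = subst (ℚ._< 1ℚ) (sym (ℚ.*-identityʳ q)) q<1
^<1 q 0≤q q<1 (2+ e) = ℚ.≤-<-trans
  (subst (q * q ^ suc e ℚ.≤_) (ℚ.*-identityʳ q)
    (ℚ.*-monoˡ-≤-nonNeg q {{ℚ.nonNegative 0≤q}}
      (ℚ.<⇒≤ (^<1 q 0≤q q<1 (suc e)))))
  q<1

denominator : (e b : ℕ) .{{_ : NonTrivial b}} → ℚ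
denominator e b = 1ℚ - ratio b ^ e

denominator-nonZero : ∀ e b .{{_ : NonTrivial b}} .{{_ : NonZero e}} →
                      ℚ.NonZero (denominator e b)
denominator-nonZero e b = ℚ.>-nonZero
  (subst (ℚ._< denominator e b) (ℚ.+-inverseʳ q)
    (ℚ.+-monoˡ-< (ℚ.- q) (^<1 (ratio b) (ratio-nonNeg b) (ratio<1 b) e)))
  where q = ratio b ^ e

-- The rational number being rounded is positive, so ∣_∣ only converts to ℕ.
d : (e b g p : ℕ) .{{_ : NonTrivial b}} .{{_ : NonZero e}} → ℕ
d e b g p = ∣ ceiling
  (_÷_ (+ (g ℕ.+ 1) / 1) (denominator e b) {{denominator-nonZero e b}}
    + + e / 1 + + p / 1) ∣

-- Write B = (b - 1)^e and C = (b - 2)^e.  By Waring's theorem every v has a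
-- preimage under S with at most v / B + g(e) digits: v % B is a sum of g(e) e-th
-- powers of digits, to which v / B digits b - 1 are appended.  If s = σ_{h+1}(u) has
-- more than d digits, then s is a minimal preimage of S(s) (the exception u is
-- harmless, since it would be periodic and hence small), so its digits b - 1 come
-- last, and comparing digit counts leaves fewer than d - e - p digits other than
-- b - 1.  So s ends in more than e + p digits b - 1.  Therefore the next number
-- s′ > s of the same height is at least s + b^(e + p): a smaller one would contain
-- a 0 that could be deleted, giving a number of that height below s.  As
-- b^(e + p) > g(e) B, a preimage of s′ has at least as many digits as the Waring
-- bound for s allows, and so exceeds some preimage of s.
module Submission where

open import Defs
open import Data.Nat.Base as ℕ
open import Data.Nat.Properties as ℕ
open import Data.Nat.DivMod
  using (m≡m%n+[m/n]*n; m%n<n; m<n⇒m%n≡m; [m+kn]%n≡m%n; m<n*o⇒m/o<n; m/n*n≤m)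
open import Data.Nat.GeneralisedArithmetic using (iterate)
open import Data.Nat.Induction using (<-rec)
open import Data.Nat.ListAction using (sum)
open import Data.Nat.Tactic.RingSolver using (solve-∀)
open import Data.Integer.Base as ℤ using (ℤ)
import Data.Integer.Properties as ℤ
import Data.Integer.DivMod as ℤ
open import Data.Rational.Base as ℚ using (ℚ; 1ℚ)
import Data.Rational.Properties as ℚ
open import Data.Rational.Solver using (module +-*-Solver)
import Data.Rational.Unnormalised.Base as ℚᵘ
import Data.Rational.Unnormalised.Properties as ℚᵘ
import Algebra.Definitions.RawSemiring ℚ.+-*-rawSemiring as ℚ^
open import Data.Digit using (Expansion; fromDigits; toDigits)
open import Data.Fin.Base using (toℕ; fromℕ<)
open import Data.Fin.Properties using (toℕ<n; toℕ-fromℕ<)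
open import Data.List.Base as List using (_∷_; [])
open import Data.Vec.Base as Vec using (Vec)
open import Data.Product.Base using (∃; ∃₂; _×_; _,_; proj₁; proj₂)
open import Data.Sum.Base using (inj₁; inj₂)
open import Relation.Nullary using (yes; no; contradiction)
open import Relation.Unary using (Decidable)
open import Relation.Binary.PropositionalEquality

-- Rational bounds

fromℤ : ℤ → ℚ
fromℤ i = i ℚ./ 1

fromℕ : ℕ → ℚ
fromℕ n = fromℤ (ℤ.+ n)

toℚᵘ-fromℤ : ∀ i → ℚ.toℚᵘ (fromℤ i) ℚᵘ.≃ ℚᵘ.mkℚᵘ i 0
toℚᵘ-fromℤ i = ℚ.toℚᵘ-fromℚᵘ (ℚᵘ.mkℚᵘ i 0)

fromℕ-+ : ∀ m n → fromℕ (m ℕ.+ n) ≡ fromℕ m ℚ.+ fromℕ n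
fromℕ-+ m n = ℚ.toℚᵘ-injective (begin
  ℚ.toℚᵘ (fromℕ (m ℕ.+ n))                      ≈⟨ toℚᵘ-fromℤ (ℤ.+ (m ℕ.+ n)) ⟩
  ℚᵘ.mkℚᵘ (ℤ.+ (m ℕ.+ n)) 0                       ≡⟨ cong (λ i → ℚᵘ.mkℚᵘ i 0)
    (cong₂ ℤ._+_ (ℤ.*-identityʳ (ℤ.+ m)) (ℤ.*-identityʳ (ℤ.+ n))) ⟨
  ℚᵘ.mkℚᵘ (ℤ.+ m) 0 ℚᵘ.+ ℚᵘ.mkℚᵘ (ℤ.+ n) 0          ≈⟨ ℚᵘ.+-cong (toℚᵘ-fromℤ (ℤ.+ m)) (toℚᵘ-fromℤ (ℤ.+ n)) ⟨
  ℚ.toℚᵘ (fromℕ m) ℚᵘ.+ ℚ.toℚᵘ (fromℕ n)        ≈⟨ ℚ.toℚᵘ-homo-+ (fromℕ m) (fromℕ n) ⟨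
  ℚ.toℚᵘ (fromℕ m ℚ.+ fromℕ n)                  ∎)
  where open ℚᵘ.≃-Reasoning

fromℕ-* : ∀ m n → fromℕ (m ℕ.* n) ≡ fromℕ m ℚ.* fromℕ n
fromℕ-* m n = ℚ.toℚᵘ-injective (begin
  ℚ.toℚᵘ (fromℕ (m ℕ.* n))                      ≈⟨ toℚᵘ-fromℤ (ℤ.+ (m ℕ.* n)) ⟩
  ℚᵘ.mkℚᵘ (ℤ.+ (m ℕ.* n)) 0                       ≡⟨ cong (λ i → ℚᵘ.mkℚᵘ i 0) (ℤ.pos-* m n) ⟩
  ℚᵘ.mkℚᵘ (ℤ.+ m) 0 ℚᵘ.* ℚᵘ.mkℚᵘ (ℤ.+ n) 0          ≈⟨ ℚᵘ.*-cong (toℚᵘ-fromℤ (ℤ.+ m)) (toℚᵘ-fromℤ (ℤ.+ n)) ⟨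
  ℚ.toℚᵘ (fromℕ m) ℚᵘ.* ℚ.toℚᵘ (fromℕ n)        ≈⟨ ℚ.toℚᵘ-homo-* (fromℕ m) (fromℕ n) ⟨
  ℚ.toℚᵘ (fromℕ m ℚ.* fromℕ n)                  ∎)
  where open ℚᵘ.≃-Reasoning

fromℤ-mono-≤ : ∀ {i j} → i ℤ.≤ j → fromℤ i ℚ.≤ fromℤ j
fromℤ-mono-≤ {i} {j} i≤j = ℚ.toℚᵘ-cancel-≤
  (ℚᵘ.≤-respˡ-≃ (ℚᵘ.≃-sym (toℚᵘ-fromℤ i)) (ℚᵘ.≤-respʳ-≃ (ℚᵘ.≃-sym (toℚᵘ-fromℤ j))
    (ℚᵘ.*≤* (ℤ.*-monoʳ-≤-nonNeg (ℤ.+ 1) i≤j))))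

fromℕ-cancel-≤ : ∀ {m n} → fromℕ m ℚ.≤ fromℕ n → m ℕ.≤ n
fromℕ-cancel-≤ {m} {n} m≤n = ℤ.drop‿+≤+ (ℤ.*-cancelʳ-≤-pos (ℤ.+ m) (ℤ.+ n) (ℤ.+ 1)
  (ℚᵘ.drop-*≤* (ℚᵘ.≤-respˡ-≃ (toℚᵘ-fromℤ (ℤ.+ m)) (ℚᵘ.≤-respʳ-≃ (toℚᵘ-fromℤ (ℤ.+ n))
    (ℚ.toℚᵘ-mono-≤ m≤n)))))

-- `d` takes the absolute value of a ceiling; the lower bound survives whatever the sign.
i≤∣i∣ : ∀ i → i ℤ.≤ ℤ.+ ℤ.∣ i ∣
i≤∣i∣ (ℤ.+ n)      = ℤ.≤-refl
i≤∣i∣ ℤ.-[1+ n ] = ℤ.-≤+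

floor-≤ : ∀ q → fromℤ (ℚ.floor q) ℚ.≤ q
floor-≤ q@record{} = ℚ.toℚᵘ-cancel-≤
  (ℚᵘ.≤-respˡ-≃ (ℚᵘ.≃-sym (toℚᵘ-fromℤ (ℚ.floor q)))
    (ℚᵘ.*≤* (subst (ℚ.floor q ℤ.* ℚ.↧ q ℤ.≤_) (sym (ℤ.*-identityʳ (ℚ.↥ q)))
      (ℤ.[n/d]*d≤n (ℚ.↥ q) (ℚ.↧ q)))))

fromℤ-neg : ∀ i → fromℤ (ℤ.- i) ≡ ℚ.- fromℤ i
fromℤ-neg i = ℚ.toℚᵘ-injective (begin
  ℚ.toℚᵘ (fromℤ (ℤ.- i))      ≈⟨ toℚᵘ-fromℤ (ℤ.- i) ⟩
  ℚᵘ.- ℚᵘ.mkℚᵘ i 0            ≈⟨ ℚᵘ.-‿cong (toℚᵘ-fromℤ i) ⟨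
  ℚᵘ.- ℚ.toℚᵘ (fromℤ i)       ≈⟨ ℚ.toℚᵘ-homo‿- (fromℤ i) ⟨
  ℚ.toℚᵘ (ℚ.- fromℤ i)        ∎)
  where open ℚᵘ.≃-Reasoning

≤-ceiling : ∀ q → q ℚ.≤ fromℤ (ℚ.ceiling q)
≤-ceiling q@record{} = subst₂ ℚ._≤_ (neg-involutive q) (sym (fromℤ-neg (ℚ.floor (ℚ.- q))))
  (ℚ.neg-antimono-≤ (floor-≤ (ℚ.- q)))
  where
  open +-*-Solver
  neg-involutive : ∀ p → ℚ.- (ℚ.- p) ≡ p
  neg-involutive = solve 1 (λ p → :- (:- p) := p) refl

-- The inequality defining `d`, over the natural numbers

module _ (k e : ℕ) .{{_ : NonZero e}} where

  private
    q^e : ℚ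
    q^e = ratio (2+ k) ℚ^.^ e
    δ = denominator e (2+ k)
    instance
      δ≢0 : ℚ.NonZero δ
      δ≢0 = denominator-nonZero e (2+ k)
      δ≥0 : ℚ.NonNegative δ
      δ≥0 = ℚ.nonNegative (subst (ℚ._≤ δ) (ℚ.+-inverseʳ q^e)
        (ℚ.+-monoˡ-≤ (ℚ.- q^e) (ℚ.<⇒≤ (^<1 (ratio (2+ k)) (ratio-nonNeg (2+ k)) (ratio<1 (2+ k)) e))))

  ratio-* : ratio (2+ k) ℚ.* fromℕ (suc k) ≡ fromℕ k
  ratio-* = ℚ.toℚᵘ-injective (begin
    ℚ.toℚᵘ (ratio (2+ k) ℚ.* fromℕ (suc k))              ≈⟨ ℚ.toℚᵘ-homo-* (ratio (2+ k)) (fromℕ (suc k)) ⟩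
    ℚ.toℚᵘ (ratio (2+ k)) ℚᵘ.* ℚ.toℚᵘ (fromℕ (suc k))    ≈⟨ ℚᵘ.*-cong
      (ℚ.toℚᵘ-fromℚᵘ (ℚᵘ.mkℚᵘ (ℤ.+ k) k)) (toℚᵘ-fromℤ (ℤ.+ suc k)) ⟩
    ℚᵘ.mkℚᵘ (ℤ.+ k) k ℚᵘ.* ℚᵘ.mkℚᵘ (ℤ.+ suc k) 0             ≈⟨ ℚᵘ.*≡* (trans
      (ℤ.*-identityʳ (ℤ.+ k ℤ.* ℤ.+ suc k))
      (cong (λ n → ℤ.+ k ℤ.* ℤ.+ n) (sym (ℕ.*-identityʳ (suc k))))) ⟩
    ℚᵘ.mkℚᵘ (ℤ.+ k) 0                                      ≈⟨ toℚᵘ-fromℤ (ℤ.+ k) ⟨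
    ℚ.toℚᵘ (fromℕ k)                                     ∎)
    where open ℚᵘ.≃-Reasoning

  ratio^-* : ∀ n → ratio (2+ k) ℚ^.^ n ℚ.* fromℕ (suc k ℕ.^ n) ≡ fromℕ (k ℕ.^ n)
  ratio^-* zero    = refl
  ratio^-* (suc n) = begin
    (r ℚ.* r ℚ^.^ n) ℚ.* fromℕ (suc k ℕ.* suc k ℕ.^ n)               ≡⟨ cong ((r ℚ.* r ℚ^.^ n) ℚ.*_)
      (fromℕ-* (suc k) (suc k ℕ.^ n)) ⟩
    (r ℚ.* r ℚ^.^ n) ℚ.* (fromℕ (suc k) ℚ.* fromℕ (suc k ℕ.^ n))     ≡⟨ interchange r (r ℚ^.^ n) _ _ ⟩
    (r ℚ.* fromℕ (suc k)) ℚ.* (r ℚ^.^ n ℚ.* fromℕ (suc k ℕ.^ n))     ≡⟨ cong₂ ℚ._*_ ratio-* (ratio^-* n) ⟩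
    fromℕ k ℚ.* fromℕ (k ℕ.^ n)                                      ≡⟨ fromℕ-* k (k ℕ.^ n) ⟨
    fromℕ (k ℕ.* k ℕ.^ n)                                            ∎
    where
    open ≡-Reasoning
    r = ratio (2+ k)
    open +-*-Solver
    interchange : ∀ x y z w → (x ℚ.* y) ℚ.* (z ℚ.* w) ≡ (x ℚ.* z) ℚ.* (y ℚ.* w)
    interchange = solve 4 (λ x y z w → (x :* y) :* (z :* w) := (x :* z) :* (y :* w)) refl

  -- d ≥ (g + 1) / (1 - C / B) + e + p, cleared of fractions and of subtractions.
  d-bound : ∀ g p → let B = suc k ℕ.^ e; C = k ℕ.^ e in
    (g ℕ.+ 1) ℕ.* B ℕ.+ (e ℕ.+ p) ℕ.* B ℕ.+ d e (2+ k) g p ℕ.* C ℕ.≤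
    d e (2+ k) g p ℕ.* B ℕ.+ (e ℕ.+ p) ℕ.* C
  d-bound g p = fromℕ-cancel-≤ (begin
    fromℕ (G ℕ.* B ℕ.+ (e ℕ.+ p) ℕ.* B ℕ.+ n ℕ.* C)        ≡⟨ expandˡ ⟩
    G′ ℚ.* B′ ℚ.+ (e′ ℚ.+ p′) ℚ.* B′ ℚ.+ n′ ℚ.* C′         ≡⟨ cong (λ x → x ℚ.* B′ ℚ.+ (e′ ℚ.+ p′) ℚ.* B′ ℚ.+ n′ ℚ.* C′) G≡ ⟩
    ((G′ ℚ.÷ δ) ℚ.* δ) ℚ.* B′ ℚ.+ (e′ ℚ.+ p′) ℚ.* B′ ℚ.+ n′ ℚ.* C′
      ≡⟨ cong (λ x → ((G′ ℚ.÷ δ) ℚ.* δ) ℚ.* B′ ℚ.+ (e′ ℚ.+ p′) ℚ.* B′ ℚ.+ n′ ℚ.* x) (ratio^-* e) ⟨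
    ((G′ ℚ.÷ δ) ℚ.* δ) ℚ.* B′ ℚ.+ (e′ ℚ.+ p′) ℚ.* B′ ℚ.+ n′ ℚ.* (q^e ℚ.* B′)
      ≡⟨ rearrangeˡ (G′ ℚ.÷ δ) q^e B′ e′ p′ n′ ⟩
    -- Splitting `B′` into `δ * B′` and `q^e * B′` isolates the quantity that `d` rounds up;
    -- replacing it by `n′` is the only inequality.
    (G′ ℚ.÷ δ ℚ.+ e′ ℚ.+ p′) ℚ.* δ ℚ.* B′ ℚ.+ (n′ ℚ.+ (e′ ℚ.+ p′)) ℚ.* (q^e ℚ.* B′)
      ≤⟨ ℚ.+-monoˡ-≤ _ (ℚ.*-monoʳ-≤-nonNeg B′ {{fromℕ-nonNeg B}} (ℚ.*-monoʳ-≤-nonNeg δ q≤n)) ⟩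
    n′ ℚ.* δ ℚ.* B′ ℚ.+ (n′ ℚ.+ (e′ ℚ.+ p′)) ℚ.* (q^e ℚ.* B′)
      ≡⟨ rearrangeʳ q^e B′ e′ p′ n′ ⟩
    n′ ℚ.* B′ ℚ.+ (e′ ℚ.+ p′) ℚ.* (q^e ℚ.* B′)              ≡⟨ cong (λ x → n′ ℚ.* B′ ℚ.+ (e′ ℚ.+ p′) ℚ.* x) (ratio^-* e) ⟩
    n′ ℚ.* B′ ℚ.+ (e′ ℚ.+ p′) ℚ.* C′                        ≡⟨ expandʳ ⟨
    fromℕ (n ℕ.* B ℕ.+ (e ℕ.+ p) ℕ.* C)                     ∎)
    where
    open ℚ.≤-Reasoning
    open +-*-Solver
    B C G n : ℕ
    B = suc k ℕ.^ e
    C = k ℕ.^ e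
    G = g ℕ.+ 1
    n = d e (2+ k) g p
    B′ C′ G′ n′ e′ p′ : ℚ
    B′ = fromℕ B
    C′ = fromℕ C
    G′ = fromℕ G
    n′ = fromℕ n
    e′ = fromℕ e
    p′ = fromℕ p
    fromℕ-nonNeg : ∀ m → ℚ.NonNegative (fromℕ m)
    fromℕ-nonNeg m = ℚ.normalize-nonNeg m 1
    q≤n : G′ ℚ.÷ δ ℚ.+ e′ ℚ.+ p′ ℚ.≤ n′
    q≤n = ℚ.≤-trans (≤-ceiling (G′ ℚ.÷ δ ℚ.+ e′ ℚ.+ p′))
      (fromℤ-mono-≤ (i≤∣i∣ (ℚ.ceiling (G′ ℚ.÷ δ ℚ.+ e′ ℚ.+ p′))))
    G≡ : G′ ≡ (G′ ℚ.÷ δ) ℚ.* δ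
    G≡ = sym (trans (ℚ.*-assoc G′ (ℚ.1/ δ) δ)
      (trans (cong (G′ ℚ.*_) (ℚ.*-inverseˡ δ)) (ℚ.*-identityʳ G′)))
    product : ∀ o → fromℕ ((e ℕ.+ p) ℕ.* o) ≡ (e′ ℚ.+ p′) ℚ.* fromℕ o
    product o = trans (fromℕ-* (e ℕ.+ p) o) (cong (ℚ._* fromℕ o) (fromℕ-+ e p))
    expandˡ : fromℕ (G ℕ.* B ℕ.+ (e ℕ.+ p) ℕ.* B ℕ.+ n ℕ.* C) ≡
              G′ ℚ.* B′ ℚ.+ (e′ ℚ.+ p′) ℚ.* B′ ℚ.+ n′ ℚ.* C′
    expandˡ = trans (fromℕ-+ (G ℕ.* B ℕ.+ (e ℕ.+ p) ℕ.* B) (n ℕ.* C)) (cong₂ ℚ._+_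
      (trans (fromℕ-+ (G ℕ.* B) ((e ℕ.+ p) ℕ.* B)) (cong₂ ℚ._+_ (fromℕ-* G B) (product B)))
      (fromℕ-* n C))
    expandʳ : fromℕ (n ℕ.* B ℕ.+ (e ℕ.+ p) ℕ.* C) ≡ n′ ℚ.* B′ ℚ.+ (e′ ℚ.+ p′) ℚ.* C′
    expandʳ = trans (fromℕ-+ (n ℕ.* B) ((e ℕ.+ p) ℕ.* C)) (cong₂ ℚ._+_ (fromℕ-* n B) (product C))
    rearrangeˡ : ∀ x r B e p n →
      (x ℚ.* (1ℚ ℚ.- r)) ℚ.* B ℚ.+ (e ℚ.+ p) ℚ.* B ℚ.+ n ℚ.* (r ℚ.* B) ≡
      (x ℚ.+ e ℚ.+ p) ℚ.* (1ℚ ℚ.- r) ℚ.* B ℚ.+ (n ℚ.+ (e ℚ.+ p)) ℚ.* (r ℚ.* B)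
    rearrangeˡ = solve 6 (λ x r B e p n →
      (x :* (con 1ℚ :- r)) :* B :+ (e :+ p) :* B :+ n :* (r :* B) :=
      (x :+ e :+ p) :* (con 1ℚ :- r) :* B :+ (n :+ (e :+ p)) :* (r :* B)) refl
    rearrangeʳ : ∀ r B e p n →
      n ℚ.* (1ℚ ℚ.- r) ℚ.* B ℚ.+ (n ℚ.+ (e ℚ.+ p)) ℚ.* (r ℚ.* B) ≡
      n ℚ.* B ℚ.+ (e ℚ.+ p) ℚ.* (r ℚ.* B)
    rearrangeʳ = solve 5 (λ r B e p n →
      n :* (con 1ℚ :- r) :* B :+ (n :+ (e :+ p)) :* (r :* B) :=
      n :* B :+ (e :+ p) :* (r :* B)) refl

-- Digit sums and attracted numbers

-- Decidability replaces excluded middle: the search below `n` either finds a smaller witness, to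
-- which the induction passes, or shows `n` least.
least : ∀ {P : ℕ → Set} → Decidable P → ∀ n → P n → ∃ (IsLeast P)
least {P} P? = <-rec _ go
  where
  go : ∀ n → (∀ {m} → m < n → P m → ∃ (IsLeast P)) → P n → ∃ (IsLeast P)
  go n rec pn with anyUpTo? P? n
  ... | yes (m , m<n , pm) = rec m<n pm
  ... | no ¬∃ = n , pn , λ m pm → ≮⇒≥ (λ m<n → ¬∃ (m , m<n , pm))

-- Exponential bounds and `e ≤ g(e)`

n<2^n : ∀ n → n < 2 ^ n
n<2^n zero    = z<s
n<2^n (suc n) = begin-strict
  suc n           ≤⟨ n<2^n n ⟩
  2 ^ n           <⟨ ^-monoʳ-< 2 (s≤s z<s) (n<1+n n) ⟩
  2 ^ suc n       ∎
  where open ≤-Reasoning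

2*n≤2^n : ∀ n → 2 * n ≤ 2 ^ n
2*n≤2^n zero    = z≤n
2*n≤2^n (suc n) = *-monoʳ-≤ 2 (n<2^n n)

-- A base of at least 2 would contribute `2 ^ e` by itself, so every base is 0 or 1 and every power
-- at most 1.
sum-powers<2^e⇒sum≤length : ∀ e .{{_ : NonZero e}} {g} (xs : Vec ℕ g) →
  Vec.sum (Vec.map (_^ e) xs) < 2 ^ e → Vec.sum (Vec.map (_^ e) xs) ≤ g
sum-powers<2^e⇒sum≤length e Vec.[]       _   = z≤n
sum-powers<2^e⇒sum≤length e (x Vec.∷ xs) lt = +-mono-≤ x^e≤1
  (sum-powers<2^e⇒sum≤length e xs (≤-<-trans (m≤n+m _ (x ^ e)) lt))
  where
  x<2 : x < 2
  x<2 = ≰⇒> λ 2≤x → <⇒≱ (≤-<-trans (m≤m+n (x ^ e) _) lt) (^-monoˡ-≤ e 2≤x)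
  x^e≤1 : x ^ e ≤ 1
  x^e≤1 = subst (x ^ e ≤_) (^-zeroˡ e) (^-monoˡ-≤ e (s≤s⁻¹ x<2))

-- 2 ^ e ∸ 1 is a sum of e-th powers of 0 and 1 only.
sumsOfPowers⇒e≤g : ∀ e .{{_ : NonZero e}} g → SumsOfPowers e g → e ≤ g
sumsOfPowers⇒e≤g e g sums with sums (pred (2 ^ e))
... | xs , eq = begin
  e                              ≤⟨ <⇒≤pred (n<2^n e) ⟩
  pred (2 ^ e)                   ≡⟨ eq ⟨
  Vec.sum (Vec.map (_^ e) xs)    ≤⟨ sum-powers<2^e⇒sum≤length e xs
    (subst₂ _<_ (sym eq) (suc-pred (2 ^ e) {{m^n≢0 2 e}}) (n<1+n _)) ⟩
  g                              ∎
  where open ≤-Reasoning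

-- Base `b` expansions and their power sums

module _ (k e : ℕ) .{{e≢0 : NonZero e}} where

  private
    b c B C : ℕ
    b = 2+ k
    c = suc k
    B = c ^ e
    C = k ^ e

    instance
      B≢0 : NonZero B
      B≢0 = m^n≢0 c e

  0^e≡0 : 0 ^ e ≡ 0
  0^e≡0 = lemma e
    where
    lemma : ∀ e .{{_ : NonZero e}} → 0 ^ e ≡ 0
    lemma (suc e) = refl

  C<B : C < B
  C<B = ^-monoˡ-< e (n<1+n k)

  B<b^e : B < b ^ e
  B<b^e = ^-monoˡ-< e (n<1+n c)

  powerSum : Expansion b → ℕ
  powerSum ds = sum (List.map (λ a → toℕ a ^ e) ds)

  divMod-unique : ∀ {r s x y} → r < b → s < b → r + x * b ≡ s + y * b → r ≡ s × x ≡ y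
  divMod-unique {r} {s} {x} {y} r<b s<b eq =
    r≡s , *-cancelʳ-≡ x y b (+-cancelˡ-≡ s _ _ (trans (cong (_+ x * b) (sym r≡s)) eq))
    where
    open ≡-Reasoning
    r≡s : r ≡ s
    r≡s = begin
      r                  ≡⟨ m<n⇒m%n≡m r<b ⟨
      r % b              ≡⟨ [m+kn]%n≡m%n r x b ⟨
      (r + x * b) % b    ≡⟨ cong (_% b) eq ⟩
      (s + y * b) % b    ≡⟨ [m+kn]%n≡m%n s y b ⟩
      s % b              ≡⟨ m<n⇒m%n≡m s<b ⟩
      s                  ∎

  -- The lists are compared from the lowest digit. When one ends first, the other has only zeros
  -- left, and these contribute nothing because `e ≥ 1`.
  powerSum-unique : ∀ ds ds′ → fromDigits ds ≡ fromDigits ds′ → powerSum ds ≡ powerSum ds′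
  powerSum-unique []       []         eq = refl
  powerSum-unique []       (a ∷ ds′)  eq with divMod-unique {x = 0} z<s (toℕ<n a) eq
  ... | 0≡a , 0≡x = cong₂ _+_ (trans (sym 0^e≡0) (cong (_^ e) 0≡a)) (powerSum-unique [] ds′ 0≡x)
  powerSum-unique (a ∷ ds) []         eq with divMod-unique {y = 0} (toℕ<n a) z<s eq
  ... | a≡0 , x≡0 = cong₂ _+_ (trans (cong (_^ e) a≡0) 0^e≡0) (powerSum-unique ds [] x≡0)
  powerSum-unique (a ∷ ds) (a′ ∷ ds′) eq with divMod-unique (toℕ<n a) (toℕ<n a′) eq
  ... | a≡a′ , x≡x′ = cong₂ _+_ (cong (_^ e) a≡a′) (powerSum-unique ds ds′ x≡x′)

  S-fromDigits : ∀ ds {x} → fromDigits ds ≡ x → S e b x ≡ powerSum ds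
  S-fromDigits ds {x} eq =
    powerSum-unique (proj₁ (toDigits b x)) ds (trans (proj₂ (toDigits b x)) (sym eq))

  S-zero : S e b 0 ≡ 0
  S-zero = S-fromDigits [] refl

  S-step : ∀ {a} → a < b → ∀ x → S e b (a + x * b) ≡ a ^ e + S e b x
  S-step {a} a<b x = begin
    S e b (a + x * b)                     ≡⟨ S-fromDigits (fromℕ< a<b ∷ ds)
      (cong₂ (λ r y → r + y * b) (toℕ-fromℕ< a<b) ds≡x) ⟩
    toℕ (fromℕ< a<b) ^ e + powerSum ds    ≡⟨ cong₂ _+_
      (cong (_^ e) (toℕ-fromℕ< a<b)) (sym (S-fromDigits ds ds≡x)) ⟩
    a ^ e + S e b x                       ∎
    where
    open ≡-Reasoning
    ds = proj₁ (toDigits b x)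
    ds≡x = proj₂ (toDigits b x)

  -- For `n = d`, the witness `D` is `d ∸ (e + p)`; the terms `(e + p) * B` and `(e + p) * C` cancel
  -- from the bound.
  d-split : ∀ {g p n} → (g + 1) * B + (e + p) * B + n * C ≤ n * B + (e + p) * C →
            ∃ λ D → (g + 1) * B + D * C ≤ D * B × e + p + D ≤ n
  d-split {g} {p} {n} bound with ≤-total (e + p) n
  ... | inj₁ e+p≤n with m≤n⇒∃[o]m+o≡n e+p≤n
  ... | D , refl = D , +-cancelˡ-≤ ((e + p) * B + (e + p) * C) _ _
    (subst₂ _≤_ (lhs B C (g + 1) (e + p) D) (rhs B C (e + p) D) bound) , ≤-refl
    where
    lhs : ∀ B C G a D → G * B + a * B + (a + D) * C ≡ a * B + a * C + (G * B + D * C)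
    lhs = solve-∀
    rhs : ∀ B C a D → (a + D) * B + a * C ≡ a * B + a * C + D * B
    rhs = solve-∀
  -- Here `C < B` would make the left side of `bound` exceed the right by at least `(g + 1) * B`.
  d-split {g} {p} {n} bound | inj₂ n≤e+p with m≤n⇒∃[o]m+o≡n n≤e+p
  ... | i , n+i≡e+p = contradiction bound (<⇒≱ (subst
    (λ a → n * B + a * C < (g + 1) * B + a * B + n * C) n+i≡e+p (begin-strict
      n * B + (n + i) * C                  ≡⟨ lhs B C n i ⟩
      0 + (n * B + n * C + i * C)          <⟨ +-mono-<-≤ 0<[g+1]B (+-monoʳ-≤ (n * B + n * C) (*-monoʳ-≤ i (<⇒≤ C<B))) ⟩
      (g + 1) * B + (n * B + n * C + i * B)    ≡⟨ rhs B C (g + 1) n i ⟩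
      (g + 1) * B + (n + i) * B + n * C    ∎)))
    where
    open ≤-Reasoning
    0<[g+1]B : 0 < (g + 1) * B
    0<[g+1]B = *-mono-< (m≤n+m 1 g) (>-nonZero⁻¹ B)
    lhs : ∀ B C n i → n * B + (n + i) * C ≡ n * B + n * C + i * C
    lhs = solve-∀
    rhs : ∀ B C G n i → G * B + (n * B + n * C + i * B) ≡ G * B + (n + i) * B + n * C
    rhs = solve-∀

  -- S enters only through these two properties; keeping f abstract prevents
  -- toDigits from unfolding.
  module _ (f : ℕ → ℕ) (f-zero : f 0 ≡ 0)
           (f-step : ∀ {a} → a < b → ∀ x → f (a + x * b) ≡ a ^ e + f x) where

    private
      Attractedᶠ : ℕ → ℕ → ℕ → Set
      Attractedᶠ h u x = IsLeast (λ m → iterate f x m ≡ u) h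

      Isσᶠ : ℕ → ℕ → ℕ → Set
      Isσᶠ h u = IsLeast (λ x → 1 ≤ x × Attractedᶠ h u x)

    -- Concatenating and rearranging digits

    f-*b : ∀ x → f (x * b) ≡ f x
    f-*b x = trans (f-step z<s x) (cong (_+ f x) 0^e≡0)

    x<b^[1+n]⇒x/b<b^n : ∀ {x} n → x < b ^ suc n → x / b < b ^ n
    x<b^[1+n]⇒x/b<b^n {x} n x<b^1+n = m<n*o⇒m/o<n (subst (x <_) (*-comm b (b ^ n)) x<b^1+n)

    f-concat : ∀ m {x} → x < b ^ m → ∀ y → f (x + y * b ^ m) ≡ f x + f y
    f-concat zero    {zero}  _ y = trans (cong f (*-identityʳ y)) (cong (_+ f y) (sym f-zero))
    f-concat zero    {suc x} (s≤s ()) y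
    f-concat (suc m) {x} x<b^1+m y = begin
      f (x + y * b ^ suc m)                        ≡⟨ cong (λ z → f (z + y * b ^ suc m)) (m≡m%n+[m/n]*n x b) ⟩
      f (x % b + x / b * b + y * (b * b ^ m))      ≡⟨ cong f (regroup (x % b) (x / b) b y (b ^ m)) ⟩
      f (x % b + (x / b + y * b ^ m) * b)          ≡⟨ f-step (m%n<n x b) (x / b + y * b ^ m) ⟩
      (x % b) ^ e + f (x / b + y * b ^ m)          ≡⟨ cong ((x % b) ^ e +_) (f-concat m (x<b^[1+n]⇒x/b<b^n m x<b^1+m) y) ⟩
      (x % b) ^ e + (f (x / b) + f y)              ≡⟨ +-assoc ((x % b) ^ e) (f (x / b)) (f y) ⟨
      (x % b) ^ e + f (x / b) + f y                ≡⟨ cong (_+ f y) (f-step (m%n<n x b) (x / b)) ⟨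
      f (x % b + x / b * b) + f y                  ≡⟨ cong (λ z → f z + f y) (m≡m%n+[m/n]*n x b) ⟨
      f x + f y                                    ∎
      where
      open ≡-Reasoning
      regroup : ∀ r q b y z → r + q * b + y * (b * z) ≡ r + (q + y * z) * b
      regroup = solve-∀

    -- The base-b digits of N followed by m digits b - 1.
    appendMax : ℕ → ℕ → ℕ
    appendMax zero    N = N
    appendMax (suc m) N = c + appendMax m N * b

    f-appendMax : ∀ m N → f (appendMax m N) ≡ m * B + f N
    f-appendMax zero    N = refl
    f-appendMax (suc m) N = trans (f-step (n<1+n c) (appendMax m N))
      (trans (cong (B +_) (f-appendMax m N)) (sym (+-assoc B (m * B) (f N))))

    -- Adding 1 carries through all `m` trailing digits `b - 1`.
    1+appendMax : ∀ m N → suc (appendMax m N) ≡ suc N * b ^ m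
    1+appendMax zero    N = sym (*-identityʳ (suc N))
    1+appendMax (suc m) N = begin
      suc (appendMax m N) * b     ≡⟨ cong (_* b) (1+appendMax m N) ⟩
      suc N * b ^ m * b           ≡⟨ *-assoc (suc N) (b ^ m) b ⟩
      suc N * (b ^ m * b)         ≡⟨ cong (suc N *_) (*-comm (b ^ m) b) ⟩
      suc N * b ^ suc m           ∎
      where open ≡-Reasoning

    appendMax< : ∀ m {N} n → N < b ^ n → appendMax m N < b ^ (m + n)
    appendMax< m {N} n N<b^n = begin
      suc (appendMax m N)     ≡⟨ 1+appendMax m N ⟩
      suc N * b ^ m           ≤⟨ *-monoˡ-≤ (b ^ m) N<b^n ⟩
      b ^ n * b ^ m           ≡⟨ *-comm (b ^ n) (b ^ m) ⟩
      b ^ m * b ^ n           ≡⟨ ^-distribˡ-+-* b m n ⟨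
      b ^ (m + n)             ∎
      where open ≤-Reasoning

    -- Moves `a` from above the block of digits `c` to below it. Each exchange of adjacent digits
    -- `a`, `c` into `c`, `a` adds `(c - a) * c` times a power of `b`.
    appendMax-swap : ∀ m {a} → a ≤ c → ∀ N → appendMax m (a + N * b) ≤ a + appendMax m N * b
    appendMax-swap zero    a≤c N = ≤-refl
    appendMax-swap (suc m) {a} a≤c N = begin
      c + appendMax m (a + N * b) * b             ≤⟨ +-monoʳ-≤ c (*-monoˡ-≤ b (appendMax-swap m a≤c N)) ⟩
      c + (a + appendMax m N * b) * b             ≡⟨ lhs c a (appendMax m N * b) ⟩
      c * a + (a + c + appendMax m N * b * b)     ≤⟨ +-monoˡ-≤ _ (*-monoʳ-≤ c a≤c) ⟩
      c * c + (a + c + appendMax m N * b * b)     ≡⟨ rhs c a (appendMax m N * b) ⟩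
      a + (c + appendMax m N * b) * b             ∎
      where
      open ≤-Reasoning
      lhs : ∀ c a x → c + (a + x) * suc c ≡ c * a + (a + c + x * suc c)
      lhs = solve-∀
      rhs : ∀ c a x → c * c + (a + c + x * suc c) ≡ a + (c + x) * suc c
      rhs = solve-∀

    -- Moving the digits b - 1 of z to the end does not increase z.  Of the n digits,
    -- maxes are b - 1; the others, in order, form rest.
    record Rearranged (n z : ℕ) : Set where
      field
        others maxes rest : ℕ
        others+maxes≡n : others + maxes ≡ n
        appendMax≤z    : appendMax maxes rest ≤ z
        f-preserved    : maxes * B + f rest ≡ f z
        f-rest≤        : f rest ≤ others * C

    -- The higher digits are rearranged first. A lowest digit `b - 1` then joins the block, and any
    -- other is moved above it. Zeros padding `z` to `n` digits count among `others`.
    rearrange : ∀ n {z} → z < b ^ n → Rearranged n z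
    rearrange zero {zero} _ = record
      { others = 0 ; maxes = 0 ; rest = 0 ; others+maxes≡n = refl
      ; appendMax≤z = z≤n ; f-preserved = refl ; f-rest≤ = ≤-reflexive f-zero }
    rearrange zero {suc z} (s≤s ())
    rearrange (suc n) {z} z<b^1+n with m≤n⇒m<n∨m≡n (s≤s⁻¹ (m%n<n z b))
    ... | inj₂ z%b≡c = record
      { others = others ; maxes = suc maxes ; rest = rest
      ; others+maxes≡n = trans (+-suc others maxes) (cong suc others+maxes≡n)
      ; appendMax≤z = subst (appendMax (suc maxes) rest ≤_) (sym z≡) (+-monoʳ-≤ c (*-monoˡ-≤ b appendMax≤z))
      ; f-preserved = trans (+-assoc B (maxes * B) (f rest))
          (trans (cong (B +_) f-preserved) (sym (trans (cong f z≡) (f-step (n<1+n c) (z / b)))))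
      ; f-rest≤ = f-rest≤
      }
      where
      open Rearranged (rearrange n (x<b^[1+n]⇒x/b<b^n n z<b^1+n))
      z≡ : z ≡ c + z / b * b
      z≡ = trans (m≡m%n+[m/n]*n z b) (cong (_+ z / b * b) z%b≡c)
    ... | inj₁ a<c = record
      { others = suc others ; maxes = maxes ; rest = a + rest * b
      ; others+maxes≡n = cong suc others+maxes≡n
      ; appendMax≤z = begin
          appendMax maxes (a + rest * b)     ≤⟨ appendMax-swap maxes (<⇒≤ a<c) rest ⟩
          a + appendMax maxes rest * b       ≤⟨ +-monoʳ-≤ a (*-monoˡ-≤ b appendMax≤z) ⟩
          a + z / b * b                      ≡⟨ m≡m%n+[m/n]*n z b ⟨
          z                                  ∎
      ; f-preserved = begin-equality
          maxes * B + f (a + rest * b)       ≡⟨ cong (maxes * B +_) (f-step (m%n<n z b) rest) ⟩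
          maxes * B + (a ^ e + f rest)       ≡⟨ exchange (maxes * B) (a ^ e) (f rest) ⟩
          a ^ e + (maxes * B + f rest)       ≡⟨ cong (a ^ e +_) f-preserved ⟩
          a ^ e + f (z / b)                  ≡⟨ f-step (m%n<n z b) (z / b) ⟨
          f (a + z / b * b)                  ≡⟨ cong f (m≡m%n+[m/n]*n z b) ⟨
          f z                                ∎
      ; f-rest≤ = subst (_≤ suc others * C) (sym (f-step (m%n<n z b) rest))
          (+-mono-≤ (^-monoˡ-≤ e (s≤s⁻¹ a<c)) f-rest≤)
      }
      where
      open ≤-Reasoning
      open Rearranged (rearrange n (x<b^[1+n]⇒x/b<b^n n z<b^1+n))
      a = z % b
      exchange : ∀ x y w → x + (y + w) ≡ y + (x + w)
      exchange = solve-∀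

    f≤ : ∀ n {z} → z < b ^ n → f z ≤ n * B
    f≤ n {z} z<b^n = begin
      f z                          ≡⟨ f-preserved ⟨
      maxes * B + f rest           ≤⟨ +-monoʳ-≤ (maxes * B) (≤-trans f-rest≤ (*-monoʳ-≤ others (<⇒≤ C<B))) ⟩
      maxes * B + others * B       ≡⟨ *-distribʳ-+ B maxes others ⟨
      (maxes + others) * B         ≡⟨ cong (_* B) (trans (+-comm maxes others) others+maxes≡n) ⟩
      n * B                        ∎
      where
      open ≤-Reasoning
      open Rearranged (rearrange n z<b^n)

    -- `n` is one less than the number of digits; the search descends from the crude bound
    -- `x < b ^ x`.
    digitLength : ∀ {x} → 1 ≤ x → ∃ λ n → b ^ n ≤ x × x < b ^ suc n
    digitLength {x} 1≤x = go x (<-≤-trans (n<2^n x) (^-monoˡ-≤ x (s≤s (s≤s z≤n))))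
      where
      go : ∀ m → x < b ^ m → ∃ λ n → b ^ n ≤ x × x < b ^ suc n
      go zero    x<1 = contradiction 1≤x (<⇒≱ x<1)
      go (suc m) x<b^1+m with x <? b ^ m
      ... | yes x<b^m = go m x<b^m
      ... | no  x≮b^m = m , ≮⇒≥ x≮b^m , x<b^1+m

    b^-cancel-< : ∀ {m n} → b ^ m < b ^ n → m < n
    b^-cancel-< b^m<b^n = ≰⇒> λ n≤m → <⇒≱ b^m<b^n (^-monoʳ-≤ b n≤m)

    -- A base of at least `b` would contribute `b ^ e` by itself, so all the bases are digits, and
    -- they form `z`.
    fromPowers : ∀ {g} (xs : Vec ℕ g) → Vec.sum (Vec.map (_^ e) xs) < b ^ e →
                 ∃ λ z → z < b ^ g × f z ≡ Vec.sum (Vec.map (_^ e) xs)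
    fromPowers Vec.[] _ = 0 , z<s , f-zero
    fromPowers {suc g} (x Vec.∷ xs) lt with fromPowers xs (≤-<-trans (m≤n+m _ (x ^ e)) lt)
    ... | z , z<b^g , fz≡ = x + z * b , x+zb< , trans (f-step x<b z) (cong (x ^ e +_) fz≡)
      where
      open ≤-Reasoning
      x<b : x < b
      x<b = ≰⇒> λ b≤x → <⇒≱ (≤-<-trans (m≤m+n (x ^ e) _) lt) (^-monoˡ-≤ e b≤x)
      x+zb< : x + z * b < b ^ suc g
      x+zb< = begin-strict
        x + z * b       <⟨ +-monoˡ-< (z * b) x<b ⟩
        suc z * b       ≤⟨ *-monoˡ-≤ b z<b^g ⟩
        b ^ g * b       ≡⟨ *-comm (b ^ g) b ⟩
        b ^ suc g       ∎

    -- Heights along an orbit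

    iterate-zero : ∀ h → iterate f 0 h ≡ 0
    iterate-zero zero    = refl
    iterate-zero (suc h) = trans (cong (λ x → iterate f x h) f-zero) (iterate-zero h)

    attracted⇒positive : ∀ {h u x} → 1 ≤ u → Attractedᶠ h u x → 1 ≤ x
    attracted⇒positive {h} {x = zero}  1≤u (eq , _) = contradiction (trans (sym eq) (iterate-zero h)) (>⇒≢ 1≤u)
    attracted⇒positive     {x = suc x} _   _ = z<s

    attracted-f : ∀ {h u x} → Attractedᶠ (suc h) u x → Attractedᶠ h u (f x)
    attracted-f (eq , min) = eq , λ m eq′ → s≤s⁻¹ (min (suc m) eq′)

    -- If `x` were `u`, its height would be 0.
    attracted-pred : ∀ {h u x} → x ≢ u → Attractedᶠ h u (f x) → Attractedᶠ (suc h) u x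
    attracted-pred x≢u (eq , min) = eq , λ
      { zero    x≡u → contradiction x≡u x≢u
      ; (suc m) eq′ → s≤s (min m eq′) }

    -- Waring preimages and the decrease of `f` on large numbers

    module _ (g p : ℕ) (sums : SumsOfPowers e g) (g<b^p : g < b ^ p) where

      -- The remainder is below `B < b ^ e`, so its Waring bases are digits; the quotient counts the
      -- digits `b - 1`.
      preimage : ∀ v → ∃ λ z → z < b ^ (v / B + g) × f z ≡ v
      preimage v with sums (v % B)
      ... | xs , sum≡ with fromPowers xs (subst (_< b ^ e) (sym sum≡) (<-trans (m%n<n v B) B<b^e))
      ... | z , z<b^g , fz≡ = appendMax (v / B) z , appendMax< (v / B) g z<b^g , (begin
        f (appendMax (v / B) z)     ≡⟨ f-appendMax (v / B) z ⟩
        v / B * B + f z             ≡⟨ +-comm (v / B * B) (f z) ⟩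
        f z + v / B * B             ≡⟨ cong (_+ v / B * B) (trans fz≡ sum≡) ⟩
        v % B + v / B * B           ≡⟨ m≡m%n+[m/n]*n v B ⟨
        v                           ∎)
        where open ≡-Reasoning

      e≤g : e ≤ g
      e≤g = sumsOfPowers⇒e≤g e g sums

      1≤p : 1 ≤ p
      1≤p = b^-cancel-< (≤-<-trans (≤-trans (>-nonZero⁻¹ e) e≤g) g<b^p)

      -- For `n = e + i`, the bounds `e ≤ g` and `1 ≤ p` give `e < i`, so `n + 1 ≤ 2 * i ≤ b ^ i`,
      -- while `B < b ^ e`.
      [1+n]B<b^n : ∀ {n} → e + p + g ≤ n → suc n * B < b ^ n
      [1+n]B<b^n {n} le with m≤n⇒∃[o]m+o≡n le
      ... | o , refl = begin-strict
        suc (e + p + g + o) * B     ≤⟨ *-monoˡ-≤ B (begin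
          suc (e + p + g + o)         ≡⟨ cong suc (trans (cong (_+ o) (+-assoc e p g)) (+-assoc e (p + g) o)) ⟩
          suc (e + i)                 ≤⟨ +-monoˡ-≤ i 1+e≤i ⟩
          i + i                       ≡⟨ cong (i +_) (+-identityʳ i) ⟨
          2 * i                       ≤⟨ 2*n≤2^n i ⟩
          2 ^ i                       ≤⟨ ^-monoˡ-≤ i (s≤s (s≤s z≤n)) ⟩
          b ^ i                       ∎) ⟩
        b ^ i * B                   <⟨ *-monoʳ-< (b ^ i) {{m^n≢0 b i}} B<b^e ⟩
        b ^ i * b ^ e               ≡⟨ *-comm (b ^ i) (b ^ e) ⟩
        b ^ e * b ^ i               ≡⟨ ^-distribˡ-+-* b e i ⟨
        b ^ (e + i)                 ≡⟨ cong (b ^_) (trans (cong (_+ o) (+-assoc e p g)) (+-assoc e (p + g) o)) ⟨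
        b ^ (e + p + g + o)         ∎
        where
        open ≤-Reasoning
        i = p + g + o
        1+e≤i : suc e ≤ i
        1+e≤i = ≤-trans (+-mono-≤ 1≤p e≤g) (m≤m+n (p + g) o)

      -- If `y` has `n + 1` digits, then `z` has at most as many, and
      -- `f z ≤ (n + 1) * B < b ^ n ≤ y`.
      f< : ∀ {y z} → b ^ (e + p + g) ≤ y → z ≤ y → f z < y
      f< {y} {z} large z≤y with digitLength (≤-trans (m^n>0 b (e + p + g)) large)
      ... | n , b^n≤y , y<b^1+n = begin-strict
        f z            ≤⟨ f≤ (suc n) (≤-<-trans z≤y y<b^1+n) ⟩
        suc n * B      <⟨ [1+n]B<b^n (s≤s⁻¹ (b^-cancel-< {e + p + g} {suc n} (≤-<-trans large y<b^1+n))) ⟩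
        b ^ n          ≤⟨ b^n≤y ⟩
        y              ∎
        where open ≤-Reasoning

      iterate< : ∀ {y z} → b ^ (e + p + g) ≤ y → z < y → ∀ m → iterate f z m < y
      iterate< large z<y zero    = z<y
      iterate< large z<y (suc m) = iterate< large (f< large (<⇒≤ z<y)) m

      -- If `y ≥ b ^ (e + p + g)`, all iterates from `f y` on stay below `y`, so the orbit cannot
      -- return.
      periodic⇒small : ∀ {y} m → iterate f (f y) m ≡ y → y < b ^ (e + p + g)
      periodic⇒small m eq = ≰⇒> λ large → <-irrefl eq (iterate< large (f< large ≤-refl) m)

      -- If y = u then u is periodic, hence so small that u * b can replace y.
      σ-minimal : ∀ {h u s} → 1 ≤ u → Isσᶠ (suc h) u s → b ^ suc (e + p + g) ≤ s →
                  ∀ {y} → Attractedᶠ h u (f y) → s ≤ y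
      σ-minimal {h} {u} 1≤u (_ , min) large {y} att with y ≟ u
      ... | no y≢u = min y (attracted⇒positive 1≤u y-att , y-att)
        where y-att = attracted-pred y≢u att
      ... | yes refl = contradiction s≤u*b (<⇒≱ (<-≤-trans u*b< large))
        where
        u*b≢u : y * b ≢ y
        u*b≢u = >⇒≢ (m<m*n y b {{>-nonZero 1≤u}} (s≤s z<s))
        u*b-att : Attractedᶠ (suc h) u (y * b)
        u*b-att = attracted-pred u*b≢u (subst (Attractedᶠ h u) (sym (f-*b y)) att)
        s≤u*b = min (y * b) (attracted⇒positive 1≤u u*b-att , u*b-att)
        u*b< : y * b < b ^ suc (e + p + g)
        u*b< = subst (_< b ^ suc (e + p + g)) (*-comm b y) (*-monoʳ-< b (periodic⇒small h (proj₁ att)))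

      -- Here `j` counts digits other than `b - 1`. Each falls short of `B` by at least `B - C`; the
      -- total shortfall is at most `g * B`, which is less than `D * (B - C)`.
      surplus-bound : ∀ {D j} → (g + 1) * B + D * C ≤ D * B → j * B ≤ j * C + g * B → j < D
      surplus-bound {D} {j} D-large j-small = ≰⇒> λ D≤j → let i , D+i≡j = m≤n⇒∃[o]m+o≡n D≤j in
        <⇒≱ (+-monoˡ-< (i * B + (g * B + (D * B + D * C))) (>-nonZero⁻¹ B))
          (begin
          B + (i * B + (g * B + (D * B + D * C)))           ≡⟨ lhs B C D i g ⟩
          ((g + 1) * B + D * C) + (D + i) * B               ≤⟨ +-mono-≤ D-large (subst (λ j → j * B ≤ j * C + g * B) (sym D+i≡j) j-small) ⟩
          D * B + ((D + i) * C + g * B)                     ≡⟨ rhs B C D i g ⟩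
          i * C + (g * B + (D * B + D * C))                 ≤⟨ +-monoˡ-≤ _ (*-monoʳ-≤ i (<⇒≤ C<B)) ⟩
          i * B + (g * B + (D * B + D * C))                 ∎)
        where
        open ≤-Reasoning
        lhs : ∀ B C D i g → B + (i * B + (g * B + (D * B + D * C))) ≡ ((g + 1) * B + D * C) + (D + i) * B
        lhs = solve-∀
        rhs : ∀ B C D i g → D * B + ((D + i) * C + g * B) ≡ i * C + (g * B + (D * B + D * C))
        rhs = solve-∀

      [v/B+g]*B≤v+gB : ∀ v → (v / B + g) * B ≤ v + g * B
      [v/B+g]*B≤v+gB v = begin
        (v / B + g) * B          ≡⟨ *-distribʳ-+ B (v / B) g ⟩
        v / B * B + g * B        ≤⟨ +-monoˡ-≤ (g * B) (m/n*n≤m v B) ⟩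
        v + g * B                ∎
        where open ≤-Reasoning

      -- Least numbers of given height from `b ^ δ` on, with `δ` in the role of `d`

      module _ (D δ : ℕ) (D-large : (g + 1) * B + D * C ≤ D * B) (e+p+D≤δ : e + p + D ≤ δ) where

        -- Dropping `D * C` from `D-large` gives `g + 1 ≤ D`.
        large : suc (e + p + g) ≤ δ
        large = begin
          suc (e + p + g)     ≡⟨ trans (+-comm 1 (e + p + g)) (+-assoc (e + p) g 1) ⟩
          e + p + (g + 1)     ≤⟨ +-monoʳ-≤ (e + p) (*-cancelʳ-≤ (g + 1) D B (m+n≤o⇒m≤o _ D-large)) ⟩
          e + p + D           ≤⟨ e+p+D≤δ ⟩
          δ                   ∎
          where open ≤-Reasoning

        -- `s` is compared with two numbers of the same image: its rearrangement forces the digits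
        -- `b - 1` to the end, and the Waring preimage limits the digit count. A gap of `b ^ m`
        -- takes `m + 1` such digits, hence `suc m`.
        σ-trailing-max : ∀ {h u s} → 1 ≤ u → Isσᶠ (suc h) u s → b ^ δ ≤ s →
                         ∃₂ λ m N → e + p ≤ m × s ≡ appendMax (suc m) N
        σ-trailing-max {h} {u} {s} 1≤u σs b^δ≤s
          with digitLength (≤-trans (m^n>0 b δ) b^δ≤s) | preimage (f s)
        ... | n , b^n≤s , s<b^1+n | z , z< , fz≡fs = result maxes s≡ e+p<maxes
          where
          open ≤-Reasoning
          open Rearranged (rearrange (suc n) s<b^1+n)
          minimal : ∀ {y} → f y ≡ f s → s ≤ y
          minimal fy≡fs = σ-minimal 1≤u σs (≤-trans (^-monoʳ-≤ b large) b^δ≤s)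
            (subst (Attractedᶠ h u) (sym fy≡fs) (attracted-f (proj₂ (proj₁ σs))))
          s≡ : s ≡ appendMax maxes rest
          s≡ = ≤-antisym (minimal (trans (f-appendMax maxes rest) f-preserved)) appendMax≤z
          1+n≤ : suc n ≤ f s / B + g
          1+n≤ = b^-cancel-< (≤-<-trans (≤-trans b^n≤s (minimal fz≡fs)) z<)
          others< : others < D
          others< = surplus-bound D-large (+-cancelˡ-≤ (maxes * B) _ _ (begin
            maxes * B + others * B                   ≡⟨ *-distribʳ-+ B maxes others ⟨
            (maxes + others) * B                     ≡⟨ cong (_* B) (trans (+-comm maxes others) others+maxes≡n) ⟩
            suc n * B                                ≤⟨ *-monoˡ-≤ B 1+n≤ ⟩
            (f s / B + g) * B                        ≤⟨ [v/B+g]*B≤v+gB (f s) ⟩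
            f s + g * B                              ≡⟨ cong (_+ g * B) f-preserved ⟨
            maxes * B + f rest + g * B               ≡⟨ +-assoc (maxes * B) (f rest) (g * B) ⟩
            maxes * B + (f rest + g * B)             ≤⟨ +-monoʳ-≤ (maxes * B) (+-monoˡ-≤ (g * B) f-rest≤) ⟩
            maxes * B + (others * C + g * B)         ∎))
          e+p<maxes : e + p < maxes
          e+p<maxes = +-cancelʳ-< D (e + p) maxes (begin-strict
            e + p + D              ≤⟨ e+p+D≤δ ⟩
            δ                      <⟨ b^-cancel-< (≤-<-trans b^δ≤s s<b^1+n) ⟩
            suc n                  ≡⟨ others+maxes≡n ⟨
            others + maxes         ≤⟨ +-monoˡ-≤ maxes (<⇒≤ others<) ⟩
            D + maxes              ≡⟨ +-comm D maxes ⟩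
            maxes + D              ∎)
          result : ∀ m → s ≡ appendMax m rest → e + p < m →
                   ∃₂ λ m N → e + p ≤ m × s ≡ appendMax (suc m) N
          result (suc m) eq lt = m , rest , s≤s⁻¹ lt , eq

        -- Otherwise s′ has a 0 in position m, and deleting it gives a number
        -- below s with the same image as s′.
        σ-gap : ∀ {h u s} → 1 ≤ u → Isσᶠ (suc h) u s → b ^ δ ≤ s →
                ∀ {s′} → Attractedᶠ (suc h) u s′ → s < s′ →
                ∀ m {N} → s ≡ appendMax (suc m) N → s + b ^ m ≤ s′
        σ-gap {h} {u} {s} 1≤u σs b^δ≤s {s′} att s<s′ m {N} s≡ with m≤n⇒∃[o]m+o≡n s<s′
        ... | o , refl = ≮⇒≥ λ s′< → <⇒≱ (deleted< s′<) (σ-minimal 1≤u σs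
            (≤-trans (^-monoʳ-≤ b large) b^δ≤s)
            (subst (Attractedᶠ h u) (same-image s′<) (attracted-f att)))
          where
          -- So `s′ = o + suc N * b * b ^ m` with `o < b ^ m`, and its digit in position `m` is that
          -- of `suc N * b` in position 0.
          1+s≡ : suc s ≡ suc N * b ^ suc m
          1+s≡ = trans (cong suc s≡) (1+appendMax (suc m) N)
          1+o<b^m : suc s + o < s + b ^ m → suc o < b ^ m
          1+o<b^m s′< = +-cancelˡ-< s _ _ (subst (_< s + b ^ m) (sym (+-suc s o)) s′<)
          same-image : suc s + o < s + b ^ m → f (suc s + o) ≡ f (o + suc N * b ^ m)
          same-image s′< = begin
            f (suc s + o)                       ≡⟨ cong f (trans (+-comm (suc s) o) (cong (o +_) 1+s≡)) ⟩
            f (o + suc N * (b * b ^ m))         ≡⟨ cong (λ y → f (o + y)) (*-assoc (suc N) b (b ^ m)) ⟨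
            f (o + suc N * b * b ^ m)           ≡⟨ f-concat m o< (suc N * b) ⟩
            f o + f (suc N * b)                 ≡⟨ cong (f o +_) (f-*b (suc N)) ⟩
            f o + f (suc N)                     ≡⟨ f-concat m o< (suc N) ⟨
            f (o + suc N * b ^ m)               ∎
            where
            open ≡-Reasoning
            o< = <-trans (n<1+n o) (1+o<b^m s′<)
          deleted< : suc s + o < s + b ^ m → o + suc N * b ^ m < s
          deleted< s′< = s<s⁻¹ (begin-strict
            -- The low part fits into one further multiple of `b ^ m`, and `2 + N ≤ suc N * b`
            -- because `b ≥ 2`.
            suc o + suc N * b ^ m         <⟨ +-monoˡ-< (suc N * b ^ m) (1+o<b^m s′<) ⟩
            (2 + N) * b ^ m               ≤⟨ *-monoˡ-≤ (b ^ m) 2+N≤ ⟩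
            suc N * b * b ^ m             ≡⟨ *-assoc (suc N) b (b ^ m) ⟩
            suc N * b ^ suc m             ≡⟨ 1+s≡ ⟨
            suc s                         ∎)
            where
            open ≤-Reasoning
            2+N≤ : 2 + N ≤ suc N * b
            2+N≤ = m<m*n (suc N) b (s≤s z<s)

        -- `t` is the least preimage of `s`. A competitor `y` of height `h + 1` has `f y ≥ s`.
        -- Equality gives `t ≤ y` at once; otherwise `f y` lies beyond the gap, which puts `y` at or
        -- above the Waring preimage `x ≥ t`.
        f-σ : ∀ {h u s} → 1 ≤ u → Isσᶠ h u s → b ^ δ ≤ s →
              ∃ λ t → Isσᶠ (suc h) u t × f t ≡ s
        f-σ {h} {u} {s} 1≤u σs@((1≤s , s-att) , s-min) b^δ≤s with preimage s
        ... | x , x< , fx≡s with least (λ y → f y ≟ s) x fx≡s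
        ... | t , ft≡s , t-min = t , ((attracted⇒positive 1≤u t-att , t-att) , min) , ft≡s
          where
          -- If `u` itself mapped to `s`, it would be periodic, hence below `b ^ (e + p + g)`, and
          -- so would be its image `s`.
          u≢ : ∀ {y} → f y ≡ s → y ≢ u
          u≢ {y} fy≡s refl = <⇒≱ (begin-strict
            s                          ≡⟨ fy≡s ⟨
            f y                        <⟨ iterate< ≤-refl (periodic⇒small h
              (trans (cong (λ z → iterate f z h) fy≡s) (proj₁ s-att))) 1 ⟩
            b ^ (e + p + g)            ≤⟨ ^-monoʳ-≤ b (≤-trans (n≤1+n _) large) ⟩
            b ^ δ                      ∎) b^δ≤s
            where open ≤-Reasoning
          t-att : Attractedᶠ (suc h) u t
          t-att = attracted-pred (u≢ ft≡s) (subst (Attractedᶠ h u) (sym ft≡s) s-att)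
          gap : ∀ h {s′} → Isσᶠ h u s → Attractedᶠ h u s′ → s < s′ → s + b ^ (e + p) ≤ s′
          -- Only `u` has height 0, so no `s′ > s` exists.
          gap zero    ((_ , s≡u , _) , _) (s′≡u , _) s<s′ = contradiction (trans s≡u (sym s′≡u)) (<⇒≢ s<s′)
          gap (suc h) σs′ att s<s′ with σ-trailing-max 1≤u σs′ b^δ≤s
          ... | m , N , e+p≤m , s≡ = ≤-trans (+-monoʳ-≤ s (^-monoʳ-≤ b e+p≤m))
            (σ-gap 1≤u σs′ b^δ≤s att s<s′ m s≡)
          min : ∀ y → 1 ≤ y × Attractedᶠ (suc h) u y → t ≤ y
          min y (_ , y-att)
            with m≤n⇒m<n∨m≡n (s-min (f y) (attracted⇒positive 1≤u (attracted-f y-att) , attracted-f y-att))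
          ... | inj₂ s≡fy = t-min y (sym s≡fy)
          -- A `y` below `x` has at most `s / B + g` digits, so `f y` could not reach
          -- `s + b ^ (e + p)`.
          ... | inj₁ s<fy = ≤-trans (t-min x fx≡s) (≮⇒≥ λ y<x → <⇒≱ (begin-strict
            f y                       ≤⟨ f≤ (s / B + g) (<-trans y<x x<) ⟩
            (s / B + g) * B           ≤⟨ [v/B+g]*B≤v+gB s ⟩
            s + g * B                 <⟨ +-monoʳ-< s (*-mono-< g<b^p B<b^e) ⟩
            s + b ^ p * b ^ e         ≡⟨ cong (s +_) (trans (*-comm (b ^ p) (b ^ e)) (sym (^-distribˡ-+-* b e p))) ⟩
            s + b ^ (e + p)           ∎) (gap h σs (attracted-f y-att) s<fy))
            where open ≤-Reasoning

-- The existence of the least number of height `h + 1` is part of the conclusion; least elements are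
-- unique, so `t` is that number.
corollary3p4 : ∀ (b e : ℕ) .{{_ : NonTrivial b}} .{{_ : NonZero e}} →
    ∀ (g p : ℕ) → IsWaring e g → IsExponent b g p →
    ∀ (h u : ℕ) → 1 ≤ u →
    ∀ (s : ℕ) → Isσ h e b u s → b ^ d e b g p ≤ s →
    ∃ λ t → Isσ (suc h) e b u t × S e b t ≡ s
corollary3p4 b@(2+ k) e g p (sums , _) (g<b^p , _) h u 1≤u s σs b^d≤s
  with d-split k e {g} {p} (d-bound k e g p)
... | D , D-large , e+p+D≤d =
  f-σ k e (S e b) (S-zero k e) (S-step k e) g p sums g<b^p D (d e b g p)
    D-large e+p+D≤d 1≤u σs b^d≤s
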